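{- For every integer $t\geq 4$, every graph $G$ that does not contain $K_t$ as a minor has a connected partition $H_1,\dots,H_\ell$ such that: (1) the quotient graph $Q$ obtained from $G$ by contracting each $H_i$ to a single vertex is chordal with clique number at most $t-1$ (and hence has treewidth at most $t-2$); and (2) each $H_i$ has bandwidth (and hence pathwidth and treewidth) at most $t-3$.
   Context: All graphs are finite and simple. A sequence $H_1,\dots,H_\ell$ is a connected partition of $G$ if each $H_i$ is a non-empty connected induced subgraph of $G$, the $H_i$ are pairwise vertex-disjoint, and $V(G)=V(H_1)\cup\dots\cup V(H_\ell)$. A graph $H$ has bandwidth at most $k$ if there is an ordering $v_1,\dots,v_n$ of $V(H)$ with $|i-j|\leq k$ for every edge $v_iv_j$. -}

module Defs where

open import Data.Nat using (ℕ; zero; suc; _≤_; _∸_; ∣_-_∣)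
open import Data.Fin using (Fin; toℕ)
open import Data.Bool using (Bool; true; false)
open import Data.Maybe using (Maybe; just)
open import Data.Product using (Σ; ∃; _×_; ∃-syntax)
open import Data.Sum using (_⊎_)
open import Relation.Nullary using (¬_)
open import Relation.Binary.PropositionalEquality using (_≡_; _≢_)
open import Function.Definitions using (Injective)

record Graph : Set where
  field
    n      : ℕ
    adj    : Fin n → Fin n → Bool
    sym    : ∀ u v → adj u v ≡ adj v u
    irrefl : ∀ v → adj v v ≡ false

module _ (G : Graph) where
  open Graph G

  Edge : Fin n → Fin n → Set
  Edge u v = adj u v ≡ true

  data PathIn (S : Fin n → Set) : Fin n → Fin n → Set where
    here : ∀ {u} → S u → PathIn S u u
    step : ∀ {u w v} → S u → Edge u w → PathIn S w v → PathIn S u v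

  ConnectedInduced : (Fin n → Set) → Set
  ConnectedInduced S = (∃[ v ] S v) × (∀ u v → S u → S v → PathIn S u v)

  -- K_t is a minor of G: there are t pairwise disjoint non-empty vertex
  -- sets (branch sets), each inducing a connected subgraph, with an edge
  -- between every two of them.  Disjointness is built in by describing
  -- the branch sets through a partial map μ : V(G) → Fin t.
  HasCompleteMinor : ℕ → Set
  HasCompleteMinor t =
    Σ (Fin n → Maybe (Fin t)) λ μ →
      (∀ i → ConnectedInduced (λ v → μ v ≡ just i)) ×
      (∀ i j → i ≢ j → ∃[ u ] ∃[ v ] (μ u ≡ just i × μ v ≡ just j × Edge u v))

  IsConnectedPartition : (ℓ : ℕ) → (Fin n → Fin ℓ) → Set
  IsConnectedPartition ℓ part = ∀ i → ConnectedInduced (λ v → part v ≡ i)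

  QuotientAdj : (ℓ : ℕ) → (Fin n → Fin ℓ) → Fin ℓ → Fin ℓ → Set
  QuotientAdj ℓ part i j =
    i ≢ j × ∃[ u ] ∃[ v ] (part u ≡ i × part v ≡ j × Edge u v)

  BandwidthAtMost : (Fin n → Set) → ℕ → Set
  BandwidthAtMost S k =
    Σ ℕ λ m → Σ (Fin m → Fin n) λ σ →
      Injective _≡_ _≡_ σ ×
      (∀ a → S (σ a)) ×
      (∀ v → S v → ∃[ a ] σ a ≡ v) ×
      (∀ a b → Edge (σ a) (σ b) → ∣ toℕ a - toℕ b ∣ ≤ k)

Consecutive : (k : ℕ) → Fin k → Fin k → Set
Consecutive k i j =
  (toℕ j ≡ suc (toℕ i)) ⊎ (toℕ i ≡ k ∸ 1 × toℕ j ≡ 0)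

Chordal : {ℓ : ℕ} → (Fin ℓ → Fin ℓ → Set) → Set
Chordal {ℓ} R =
  ∀ (k : ℕ) → 4 ≤ k → (c : Fin k → Fin ℓ) → Injective _≡_ _≡_ c →
    (∀ i j → Consecutive k i j → R (c i) (c j)) →
    ∃[ i ] ∃[ j ] (i ≢ j × ¬ Consecutive k i j × ¬ Consecutive k j i × R (c i) (c j))

CliqueNumberAtMost : {ℓ : ℕ} → (Fin ℓ → Fin ℓ → Set) → ℕ → Set
CliqueNumberAtMost {ℓ} R s =
  ¬ (Σ (Fin (suc s) → Fin ℓ) λ c → Injective _≡_ _≡_ c ×
       (∀ i j → i ≢ j → R (c i) (c j)))

{-# OPTIONS --safe #-}
module Submission where

-- Choose the classes greedily, keeping the classes that touch a given component C of the
-- unassigned vertices pairwise linked; as C together with these classes is a complete minor,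
-- at most t - 2 of them touch C.  Search C breadth-first from a vertex r touching one of them,
-- pick for each of the remaining q ≤ t - 3 a vertex of C touching it, and let the next class
-- consist of the tree paths from these vertices to r.  In search order it has bandwidth at
-- most q: if u precedes its neighbour w, then all parents of the vertices in (u , w] come no
-- later than u, so these vertices form an antichain of the tree and each of them is an
-- ancestor of a different chosen vertex.  The classes that a new class touches are pairwise
-- linked, so the reversed order of choice is a perfect elimination ordering of the quotient.
-- A clique on t vertices in the quotient would be a K_t minor.

open import Defs
open import Data.Nat using (ℕ; zero; suc; _≤_; _<_; _∸_; _+_; ∣_-_∣; z≤n; s≤s; z<s; s≤s⁻¹)
open import Data.Nat.Properties
open import Data.Nat.Induction using (<-wellFounded)
open import Data.Fin using (Fin; zero; suc; toℕ; fromℕ<; inject≤)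
open import Data.Fin.Properties
  using (any?; pigeonhole; toℕ-injective; toℕ-fromℕ<; toℕ<n; inject≤-injective)
import Data.Fin.Properties as Fin
open import Data.Bool using (true)
import Data.Bool.Properties as Bool
open import Data.Maybe using (Maybe; just; nothing)
import Data.Maybe as Maybe
open import Data.Maybe.Properties using (just-injective; ≡-dec)
open import Data.Product using (Σ; ∃; ∃-syntax; _×_; _,_; proj₁; proj₂)
open import Data.Sum using (_⊎_; inj₁; inj₂)
open import Data.Empty using (⊥-elim)
open import Function using (_∘_)
open import Function.Definitions using (Injective)
open import Induction.WellFounded using (Acc; acc)
open import Relation.Nullary using (¬_; Dec; yes; no; contradiction)
open import Relation.Nullary.Decidable using (map′; ¬?; _×-dec_; _⊎-dec_; decidable-stable)
open import Relation.Unary using (Decidable)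
open import Relation.Binary.Definitions using (tri<; tri≈; tri>)
open import Relation.Binary.PropositionalEquality
  using (_≡_; _≢_; refl; sym; trans; cong; subst; subst₂; ≢-sym)

-- Bounded search, increasing enumerations and function update.

least : {P : ℕ → Set} → Decidable P → ∀ m →
  (∃[ i ] i < m × P i × (∀ j → j < i → ¬ P j)) ⊎ (∀ i → i < m → ¬ P i)
least P? zero = inj₂ λ _ ()
least P? (suc m) with least P? m
... | inj₁ (i , i<m , Pi , below) = inj₁ (i , m<n⇒m<1+n i<m , Pi , below)
... | inj₂ none with P? m
...   | yes Pm = inj₁ (m , ≤-refl , Pm , none)
...   | no ¬Pm = inj₂ λ i i<1+m Pi → case (m<1+n⇒m<n∨m≡n i<1+m) Pi
  where
  case : ∀ {i} → (i < m) ⊎ (i ≡ m) → ¬ _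
  case (inj₁ i<m)  = none _ i<m
  case (inj₂ refl) = ¬Pm

StrictlyMonotone : ∀ {M m} → (Fin M → Fin m) → Set
StrictlyMonotone g = ∀ a b → toℕ a < toℕ b → toℕ (g a) < toℕ (g b)

strictlyMonotone⇒injective : ∀ {M m} (g : Fin M → Fin m) → StrictlyMonotone g → Injective _≡_ _≡_ g
strictlyMonotone⇒injective g mono {a} {b} eq with <-cmp (toℕ a) (toℕ b)
... | tri< a<b _ _ = ⊥-elim (<-irrefl (cong toℕ eq) (mono a b a<b))
... | tri≈ _ a≡b _ = toℕ-injective a≡b
... | tri> _ _ b<a = ⊥-elim (<-irrefl (cong toℕ (sym eq)) (mono b a b<a))

-- The listing is increasing and not merely injective: the bandwidth bound compares ranks in the
-- list with positions in the search order.
record Enumeration {m : ℕ} (P : Fin m → Set) : Set where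
  field
    size     : ℕ
    at       : Fin size → Fin m
    monotone : StrictlyMonotone at
    sound    : ∀ a → P (at a)
    complete : ∀ i → P i → ∃[ a ] at a ≡ i

enumerate : ∀ {m} {P : Fin m → Set} → Decidable P → Enumeration P
enumerate {zero} P? = record
  { size = 0 ; at = λ () ; monotone = λ () ; sound = λ () ; complete = λ () }
enumerate {suc m} {P} P? with P? zero
... | yes P0 = record
  { size = suc size ; at = at′ ; monotone = monotone′ ; sound = sound′ ; complete = complete′ }
  where
  open Enumeration (enumerate (P? ∘ suc))
  at′ : Fin (suc size) → Fin (suc m)
  at′ zero    = zero
  at′ (suc a) = suc (at a)
  monotone′ : StrictlyMonotone at′
  monotone′ zero    (suc b) _   = z<s
  monotone′ (suc a) (suc b) a<b = s≤s (monotone a b (s≤s⁻¹ a<b))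
  sound′ : ∀ a → P (at′ a)
  sound′ zero    = P0
  sound′ (suc a) = sound a
  complete′ : ∀ i → P i → ∃[ a ] at′ a ≡ i
  complete′ zero    _  = zero , refl
  complete′ (suc i) Pi with complete i Pi
  ... | a , eq = suc a , cong suc eq
... | no ¬P0 = record
  { size = size ; at = suc ∘ at ; monotone = λ a b a<b → s≤s (monotone a b a<b)
  ; sound = sound ; complete = complete′ }
  where
  open Enumeration (enumerate (P? ∘ suc))
  complete′ : ∀ i → P i → ∃[ a ] suc (at a) ≡ i
  complete′ zero    P0 = ⊥-elim (¬P0 P0)
  complete′ (suc i) Pi with complete i Pi
  ... | a , eq = a , cong suc eq

argmin : ∀ {k} (f : Fin (suc k) → ℕ) → ∃[ x ] ∀ y → f x ≤ f y
argmin {zero}  f = zero , λ { zero → ≤-refl }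
argmin {suc k} f with argmin (f ∘ suc)
... | x , min with ≤-total (f zero) (f (suc x))
...   | inj₁ f0≤fx = zero  , λ { zero → ≤-refl ; (suc y) → ≤-trans f0≤fx (min y) }
...   | inj₂ fx≤f0 = suc x , λ { zero → fx≤f0 ; (suc y) → min y }

module _ {A : Set} (f : ℕ → A) (m : ℕ) (x : A) where

  update : ℕ → A
  update i with i ≟ m
  ... | yes _ = x
  ... | no _  = f i

  update-at : update m ≡ x
  update-at with m ≟ m
  ... | yes _  = refl
  ... | no m≢m = ⊥-elim (m≢m refl)

  update-below : ∀ {i} → i < m → update i ≡ f i
  update-below {i} i<m with i ≟ m
  ... | yes refl = ⊥-elim (<-irrefl refl i<m)
  ... | no _     = refl

-- Perfect elimination orderings

Consecutive⇒≢ : ∀ k (i j : Fin (4 + k)) → Consecutive (4 + k) i j → i ≢ j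
Consecutive⇒≢ k i .i (inj₁ e) refl = 1+n≢n (sym e)
Consecutive⇒≢ k i .i (inj₂ (e , e′)) refl with trans (sym e) e′
... | ()

-- On a cycle of length at least four, the way from `y` to `z` avoiding `x` has at least two steps,
-- so the two cannot be consecutive. The cases are the first position, the last one and all others.
cyclic-neighbours : ∀ k (x : Fin (4 + k)) → ∃[ y ] ∃[ z ]
  Consecutive (4 + k) y x × Consecutive (4 + k) x z ×
  y ≢ z × ¬ Consecutive (4 + k) y z × ¬ Consecutive (4 + k) z y
cyclic-neighbours k zero = y , suc zero , inj₂ (y≡ , refl) , inj₁ refl , y≢1 , ¬y1 , ¬1y
  where
  y : Fin (4 + k)
  y = fromℕ< {3 + k} ≤-refl
  y≡ : toℕ y ≡ 3 + k
  y≡ = toℕ-fromℕ< {3 + k} ≤-refl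
  y≢1 : y ≢ suc zero
  y≢1 e with trans (sym y≡) (cong toℕ e)
  ... | ()
  ¬y1 : ¬ Consecutive (4 + k) y (suc zero)
  ¬y1 (inj₁ e) with trans e (cong suc y≡)
  ... | ()
  ¬1y : ¬ Consecutive (4 + k) (suc zero) y
  ¬1y (inj₁ e) with trans (sym y≡) e
  ... | ()
cyclic-neighbours k (suc x) with toℕ x ≟ 2 + k
-- Here `suc x` is the last position 3 + k, whose successor wraps around to `zero`.
... | yes x≡ = y , zero , inj₁ (trans (cong suc x≡) (cong suc (sym y≡))) , inj₂ (cong suc x≡ , refl) , y≢0 , ¬y0 , ¬0y
  where
  y : Fin (4 + k)
  y = fromℕ< {2 + k} (n≤1+n _)
  y≡ : toℕ y ≡ 2 + k
  y≡ = toℕ-fromℕ< {2 + k} (n≤1+n _)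
  y≢0 : y ≢ zero
  y≢0 e with trans (sym y≡) (cong toℕ e)
  ... | ()
  ¬y0 : ¬ Consecutive (4 + k) y zero
  ¬y0 (inj₂ (e , _)) = 1+n≢n (trans (sym e) y≡)
  ¬0y : ¬ Consecutive (4 + k) zero y
  ¬0y (inj₁ e) with trans (sym y≡) e
  ... | ()
... | no x≢ = y , z , inj₁ (cong suc (sym y≡)) , inj₁ z≡ , y≢z , ¬yz , ¬zy
  where
  y : Fin (4 + k)
  y = fromℕ< {toℕ x} (m<n⇒m<1+n (toℕ<n x))
  y≡ : toℕ y ≡ toℕ x
  y≡ = toℕ-fromℕ< {toℕ x} (m<n⇒m<1+n (toℕ<n x))
  z< : 2 + toℕ x < 4 + k
  z< = s≤s (s≤s (≤∧≢⇒< (s≤s⁻¹ (toℕ<n x)) x≢))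
  z : Fin (4 + k)
  z = fromℕ< z<
  z≡ : toℕ z ≡ 2 + toℕ x
  z≡ = toℕ-fromℕ< z<
  y≢z : y ≢ z
  y≢z e = m≢1+n+m (toℕ x) {1} (trans (sym y≡) (trans (cong toℕ e) z≡))
  ¬yz : ¬ Consecutive (4 + k) y z
  ¬yz (inj₁ e) = 1+n≢n (suc-injective (trans (sym z≡) (trans e (cong suc y≡))))
  ¬yz (inj₂ (_ , e)) with trans (sym z≡) e
  ... | ()
  ¬zy : ¬ Consecutive (4 + k) z y
  ¬zy (inj₁ e) = m≢1+n+m (toℕ x) {2} (trans (sym y≡) (trans e (cong suc z≡)))
  ¬zy (inj₂ (e , e′)) with trans (sym e) (trans z≡ (cong (2 +_) (trans (sym y≡) e′)))
  ... | ()

-- The vertex of the cycle that comes first in the ordering has both its cycle neighbours after it;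
-- elimination makes these adjacent, which is a chord.
perfectElimination⇒chordal : ∀ {ℓ} {R : Fin ℓ → Fin ℓ → Set} →
  (∀ {i j} → R i j → R j i) →
  (∀ i j k → toℕ i < toℕ j → toℕ i < toℕ k → j ≢ k → R i j → R i k → R j k) →
  Chordal R
perfectElimination⇒chordal {R = R} R-sym elim
  (suc (suc (suc (suc k)))) (s≤s (s≤s (s≤s (s≤s z≤n)))) c c-inj cycle
  with argmin (toℕ ∘ c)
... | x , min with cyclic-neighbours k x
...   | y , z , yx , xz , y≢z , ¬yz , ¬zy =
  y , z , y≢z , ¬yz , ¬zy ,
  elim (c x) (c y) (c z)
    (above (Consecutive⇒≢ k y x yx ∘ sym)) (above (Consecutive⇒≢ k x z xz))
    (y≢z ∘ c-inj) (R-sym (cycle y x yx)) (cycle x z xz)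
  where
  above : ∀ {w} → x ≢ w → toℕ (c x) < toℕ (c w)
  above {w} x≢w = ≤∧≢⇒< (min w) (x≢w ∘ c-inj ∘ toℕ-injective)

-- Paths, connected sets and complete minors.

module _ (G : Graph) where

  open Graph G using (n; adj)

  private
    V : Set
    V = Fin n

  Edge-sym : ∀ {u v} → Edge G u v → Edge G v u
  Edge-sym {u} {v} = trans (Graph.sym G v u)

  Edge? : ∀ u v → Dec (Edge G u v)
  Edge? u v = adj u v Bool.≟ true

  Edge⇒≢ : ∀ {u v} → Edge G u v → u ≢ v
  Edge⇒≢ {u} e refl with trans (sym e) (Graph.irrefl G u)
  ... | ()

  module _ {S : V → Set} where

    path-start : ∀ {u v} → PathIn G S u v → S u
    path-start (here Su)     = Su
    path-start (step Su _ _) = Su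

    path-trans : ∀ {u v w} → PathIn G S u v → PathIn G S v w → PathIn G S u w
    path-trans (here _)      q = q
    path-trans (step Su e p) q = step Su e (path-trans p q)

    path-sym : ∀ {u v} → PathIn G S u v → PathIn G S v u
    path-sym (here Su)     = here Su
    path-sym (step Su e p) =
      path-trans (path-sym p) (step (path-start p) (Edge-sym e) (here Su))

    path-map : {T : V → Set} → (∀ {v} → S v → T v) → ∀ {u v} → PathIn G S u v → PathIn G T u v
    path-map f (here Su)     = here (f Su)
    path-map f (step Su e p) = step (f Su) e (path-map f p)

    connected-to : ∀ {r} → S r → (∀ v → S v → PathIn G S v r) → ConnectedInduced G S
    connected-to Sr p = (_ , Sr) , λ u v Su Sv → path-trans (p u Su) (path-sym (p v Sv))

    connected-resp : {T : V → Set} → (∀ {v} → S v → T v) → (∀ {v} → T v → S v) →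
      ConnectedInduced G S → ConnectedInduced G T
    connected-resp to from ((v , Sv) , p) =
      (v , to Sv) , λ u w Tu Tw → path-map to (p u w (from Tu) (from Tw))

    bandwidth-resp : {T : V → Set} → (∀ {v} → S v → T v) → (∀ {v} → T v → S v) →
      ∀ {k} → BandwidthAtMost G S k → BandwidthAtMost G T k
    bandwidth-resp to from (m , σ , inj , sound , complete , short) =
      m , σ , inj , to ∘ sound , (λ v → complete v ∘ from) , short

  -- By disjointness, the index that `any?` finds for a vertex is the only one, so the fibres of `μ`
  -- are exactly the given sets.
  branchSets⇒minor : ∀ {t} (B : Fin t → V → Set) → (∀ i → Decidable (B i)) →
    (∀ {i j v} → B i v → B j v → i ≡ j) →
    (∀ i → ConnectedInduced G (B i)) →
    (∀ i j → i ≢ j → ∃[ u ] ∃[ v ] (B i u × B j v × Edge G u v)) →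
    HasCompleteMinor G t
  branchSets⇒minor {t} B B? disjoint conn touch =
    μ , (λ i → connected-resp μ⁺ μ⁻ (conn i)) , touch′
    where
    μ : V → Maybe (Fin t)
    μ v with any? (λ i → B? i v)
    ... | yes (i , _) = just i
    ... | no _        = nothing
    μ⁺ : ∀ {i v} → B i v → μ v ≡ just i
    μ⁺ {i} {v} Biv with any? (λ i → B? i v)
    ... | yes (j , Bjv) = cong just (disjoint Bjv Biv)
    ... | no none       = ⊥-elim (none (i , Biv))
    μ⁻ : ∀ {i v} → μ v ≡ just i → B i v
    μ⁻ {i} {v} eq with any? (λ i → B? i v)
    μ⁻ refl | yes (_ , Biv) = Biv
    touch′ : ∀ i j → i ≢ j → ∃[ u ] ∃[ v ] (μ u ≡ just i × μ v ≡ just j × Edge G u v)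
    touch′ i j i≢j with touch i j i≢j
    ... | u , v , Biu , Bjv , e = u , v , μ⁺ Biu , μ⁺ Bjv , e

  -- Breadth-first search orders

  module _ {U : V → Set} (U? : Decidable U) {r : V} (Ur : U r) where

    Visited : (ℕ → V) → ℕ → V → Set
    Visited σ m v = ∃[ i ] (i < m × σ i ≡ v)

    visited? : ∀ σ m → Decidable (Visited σ m)
    visited? σ m v = anyUpTo? (λ i → σ i Fin.≟ v) m

    -- π i is the position of the first neighbour of σ i.
    record SearchOrder (m : ℕ) : Set where
      field
        σ        : ℕ → V
        π        : ℕ → ℕ
        nonempty : 0 < m
        root     : σ 0 ≡ r
        inU      : ∀ {i} → i < m → U (σ i)
        distinct : ∀ {i j} → i < j → j < m → σ i ≢ σ j
        π<       : ∀ {i} → 0 < i → π i < i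
        π-edge   : ∀ {i} → 0 < i → i < m → Edge G (σ (π i)) (σ i)
        π-first  : ∀ {i j} → i < m → j < i → Edge G (σ j) (σ i) → π i ≤ j
        π-mono   : ∀ {i j} → i ≤ j → j < m → π i ≤ π j
        frontier : ∀ {i j w} → i < m → j < m → U w → ¬ Visited σ m w → Edge G (σ j) w → π i ≤ j

    Saturated : (ℕ → V) → ℕ → Set
    Saturated σ m = ∀ {j w} → j < m → U w → Edge G (σ j) w → Visited σ m w

    start : SearchOrder 1
    start = record
      { σ = λ _ → r ; π = λ _ → 0 ; nonempty = z<s ; root = refl ; inU = λ _ → Ur
      ; distinct = λ { i<j (s≤s z≤n) → contradiction i<j λ () }
      -- `π<` speaks of all positive positions, also those from `m` on, so recursion along `π`
      -- terminates without a bound; the default value 0 complies.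
      ; π< = λ 0<i → 0<i
      ; π-edge = λ { 0<i (s≤s z≤n) → contradiction 0<i λ () }
      ; π-first = λ _ _ _ → z≤n
      ; π-mono = λ _ _ → z≤n
      ; frontier = λ _ _ _ _ _ → z≤n
      }

    module _ {m} (O : SearchOrder m) where
      open SearchOrder O

      -- Position `f` is the earliest that still has an unvisited neighbour. Hence `f` is the
      -- correct parent of `w`, and no vertex still unvisited has a neighbour before `f`.
      extend : ∀ {f w} → f < m → U w → ¬ Visited σ m w → Edge G (σ f) w →
        (∀ {j v} → j < f → U v → ¬ Visited σ m v → ¬ Edge G (σ j) v) →
        SearchOrder (suc m)
      extend {f} {w} f<m Uw w-new fw f-least = record
        { σ = σ′ ; π = π′ ; nonempty = z<s
        ; root = trans (σ-old nonempty) root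
        ; inU = inU′ ; distinct = distinct′ ; π< = π<′ ; π-edge = π-edge′
        ; π-first = π-first′ ; π-mono = π-mono′ ; frontier = frontier′
        }
        where
        σ′ = update σ m w
        π′ = update π m f
        σ-old : ∀ {i} → i < m → σ′ i ≡ σ i
        σ-old = update-below σ m w
        π-old : ∀ {i} → i < m → π′ i ≡ π i
        π-old = update-below π m f
        σ-new : σ′ m ≡ w
        σ-new = update-at σ m w
        π-new : π′ m ≡ f
        π-new = update-at π m f
        f-minimal : ∀ {j v} → U v → ¬ Visited σ m v → Edge G (σ j) v → f ≤ j
        f-minimal Uv v-new jv = ≮⇒≥ λ j<f → f-least j<f Uv v-new jv
        inU′ : ∀ {i} → i < suc m → U (σ′ i)
        inU′ i< with m<1+n⇒m<n∨m≡n i<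
        ... | inj₁ i<m rewrite σ-old i<m = inU i<m
        ... | inj₂ refl rewrite σ-new = Uw
        distinct′ : ∀ {i j} → i < j → j < suc m → σ′ i ≢ σ′ j
        distinct′ i<j j< with m<1+n⇒m<n∨m≡n j<
        ... | inj₁ j<m rewrite σ-old j<m | σ-old (<-trans i<j j<m) = distinct i<j j<m
        ... | inj₂ refl rewrite σ-new | σ-old i<j = λ eq → w-new (_ , i<j , eq)
        π<′ : ∀ {i} → 0 < i → π′ i < i
        π<′ {i} 0<i with i ≟ m
        ... | yes refl = f<m
        ... | no _     = π< 0<i
        π-edge′ : ∀ {i} → 0 < i → i < suc m → Edge G (σ′ (π′ i)) (σ′ i)
        π-edge′ 0<i i< with m<1+n⇒m<n∨m≡n i<
        ... | inj₁ i<m rewrite π-old i<m | σ-old i<m | σ-old (<-trans (π< 0<i) i<m) = π-edge 0<i i<m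
        ... | inj₂ refl rewrite π-new | σ-new | σ-old f<m = fw
        π-first′ : ∀ {i j} → i < suc m → j < i → Edge G (σ′ j) (σ′ i) → π′ i ≤ j
        π-first′ i< j<i with m<1+n⇒m<n∨m≡n i<
        ... | inj₁ i<m rewrite π-old i<m | σ-old i<m | σ-old (<-trans j<i i<m) = π-first i<m j<i
        ... | inj₂ refl rewrite π-new | σ-new | σ-old j<i = f-minimal Uw w-new
        π-mono′ : ∀ {i j} → i ≤ j → j < suc m → π′ i ≤ π′ j
        π-mono′ i≤j j< with m<1+n⇒m<n∨m≡n j<
        ... | inj₁ j<m rewrite π-old j<m | π-old (≤-<-trans i≤j j<m) = π-mono i≤j j<m
        ... | inj₂ refl with m≤n⇒m<n∨m≡n i≤j
        -- This is what `frontier` is carried for: `w` was unvisited and adjacent to `σ f`, so no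
        -- earlier parent exceeds `f`.
        ...   | inj₁ i<m rewrite π-old i<m | π-new = frontier i<m f<m Uw w-new fw
        ...   | inj₂ refl = ≤-refl
        frontier′ : ∀ {i j v} → i < suc m → j < suc m → U v → ¬ Visited σ′ (suc m) v →
          Edge G (σ′ j) v → π′ i ≤ j
        frontier′ {i} {j} {v} i< j< Uv v-new′ with m<1+n⇒m<n∨m≡n i< | m<1+n⇒m<n∨m≡n j<
        -- For j = m the bound is immediate, since all parents are at most `f` and f < m.
        ... | p | inj₂ refl = λ _ → below p
          where
          below : (i < m) ⊎ (i ≡ m) → π′ i ≤ m
          below (inj₂ refl) rewrite π-new = <⇒≤ f<m
          below (inj₁ i<m) rewrite π-old i<m =
            ≤-trans (frontier i<m f<m Uw w-new fw) (<⇒≤ f<m)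
        ... | p | inj₁ j<m rewrite σ-old j<m = below p
          where
          v-new : ¬ Visited σ m v
          v-new (k , k<m , eq) = v-new′ (k , m<n⇒m<1+n k<m , trans (σ-old k<m) eq)
          below : (i < m) ⊎ (i ≡ m) → Edge G (σ j) v → π′ i ≤ j
          below (inj₁ i<m) jv rewrite π-old i<m = frontier i<m j<m Uv v-new jv
          below (inj₂ refl) jv rewrite π-new = f-minimal Uv v-new jv

      position-injective : ∀ {i j} → i < m → j < m → σ i ≡ σ j → i ≡ j
      position-injective {i} {j} i<m j<m eq with <-cmp i j
      ... | tri< i<j _ _ = ⊥-elim (distinct i<j j<m eq)
      ... | tri≈ _ i≡j _ = i≡j
      ... | tri> _ _ j<i = ⊥-elim (distinct j<i i<m (sym eq))

      order≤n : m ≤ n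
      order≤n = ≮⇒≥ λ n<m → case (pigeonhole n<m (σ ∘ toℕ))
        where
        case : ¬ (∃[ i ] ∃[ j ] (toℕ {m} i < toℕ {m} j × σ (toℕ i) ≡ σ (toℕ j)))
        case (i , j , i<j , eq) = distinct i<j (toℕ<n j) eq

    -- The number `k` is fuel. The visited vertices are distinct, so m is at most n and the fuel
    -- cannot run out before the search is saturated.
    saturate : ∀ k {m} → SearchOrder m → m + k ≡ suc n →
      ∃[ m ] Σ (SearchOrder m) λ O → Saturated (SearchOrder.σ O) m
    saturate zero {m} O eq =
      ⊥-elim (<-irrefl refl (subst (_≤ n) (trans (sym (+-identityʳ m)) eq) (order≤n O)))
    -- Serving the least position with an unvisited neighbour is what makes the search
    -- breadth-first.
    saturate (suc k) {m} O eq with least (λ j → any? (λ w → U? w ×-dec ¬? (visited? σ m w) ×-dec Edge? (σ j) w)) m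
      where open SearchOrder O
    ... | inj₁ (f , f<m , (w , Uw , w-new , fw) , f-least) =
      saturate k (extend O f<m Uw w-new fw λ j<f Uv v-new jv → f-least _ j<f (_ , Uv , v-new , jv))
        (trans (sym (+-suc m k)) eq)
    ... | inj₂ none = m , O , λ j<m Uw jw →
      decidable-stable (visited? _ m _) λ w-new → none _ j<m (_ , Uw , w-new , jw)

    search : ∃[ m ] Σ (SearchOrder m) λ O → Saturated (SearchOrder.σ O) m
    search = saturate n start refl

    -- The search tree, with root 0 and parent function `π`.

    module Ancestry {m} (O : SearchOrder m) where
      open SearchOrder O

      data Ancestor (a : ℕ) : ℕ → Set where
        self : Ancestor a a
        via  : ∀ {s} → 0 < s → Ancestor a (π s) → Ancestor a s

      ancestor≤ : ∀ {a s} → Ancestor a s → a ≤ s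
      ancestor≤ self        = ≤-refl
      ancestor≤ (via 0<s p) = ≤-trans (ancestor≤ p) (<⇒≤ (π< 0<s))

      ancestor-parent : ∀ {a s} → 0 < a → Ancestor a s → Ancestor (π a) s
      ancestor-parent 0<a self        = via 0<a self
      ancestor-parent 0<a (via 0<s p) = via 0<s (ancestor-parent 0<a p)

      -- The ancestors of `s` form a chain along the tree path to the root, so the smaller one `a`
      -- is met at the parent of `b` or after it.
      ancestors-comparable : ∀ {a b s} → Ancestor a s → Ancestor b s → a < b → a ≤ π b
      ancestors-comparable self      q         a<b = ⊥-elim (<⇒≱ a<b (ancestor≤ q))
      ancestors-comparable (via _ p) self      a<b = ancestor≤ p
      ancestors-comparable (via _ p) (via _ q) a<b = ancestors-comparable p q a<b

      ancestor? : ∀ a s → Dec (Ancestor a s)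
      ancestor? a s = go s (<-wellFounded s)
        where
        go : ∀ s → Acc _<_ s → Dec (Ancestor a s)
        go s (acc rs) with a ≟ s
        ... | yes refl = yes self
        go zero (acc rs) | no a≢s = no λ { self → a≢s refl }
        go (suc s) (acc rs) | no a≢s =
          map′ (via z<s) (λ { self → ⊥-elim (a≢s refl) ; (via _ p) → p }) (go (π (suc s)) (rs (π< z<s)))

      -- The subtree spanned by the root and the terminals, and its bandwidth.

      module Hull {q} (terminal : Fin q → ℕ) where

        -- The root is included by hand, so that the hull is non-empty even when there are no
        -- terminals.
        Selected : ℕ → Set
        Selected i = (i ≡ 0) ⊎ (∃[ a ] Ancestor i (terminal a))

        selected? : Decidable Selected
        selected? i = (i ≟ 0) ⊎-dec any? (λ a → ancestor? i (terminal a))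

        InHull : V → Set
        InHull v = ∃[ i ] (i < m × σ i ≡ v × Selected i)

        inHull? : Decidable InHull
        inHull? v = anyUpTo? (λ i → (σ i Fin.≟ v) ×-dec selected? i) m

        root∈hull : InHull (σ 0)
        root∈hull = 0 , nonempty , refl , inj₁ refl

        parent-selected : ∀ {i} → 0 < i → Selected i → Selected (π i)
        parent-selected 0<i (inj₁ refl)    = contradiction 0<i λ ()
        parent-selected 0<i (inj₂ (a , p)) = inj₂ (a , ancestor-parent 0<i p)

        -- Parents of selected positions are selected, so the tree path from a hull vertex to the
        -- root stays in the hull.
        hull-connected : ConnectedInduced G InHull
        hull-connected = connected-to root∈hull
          λ { _ (i , i<m , refl , Si) → go i (<-wellFounded i) i<m Si }
          where
          go : ∀ i → Acc _<_ i → i < m → Selected i → PathIn G InHull (σ i) (σ 0)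
          go zero    _        i<m Si = here root∈hull
          go (suc i) (acc rs) i<m Si =
            step (_ , i<m , refl , Si) (Edge-sym (π-edge z<s i<m))
              (go (π (suc i)) (rs (π< z<s)) (<-trans (π< z<s) i<m) (parent-selected z<s Si))

        private
          open Enumeration (enumerate {m} (λ i → selected? (toℕ i)))

          τ : Fin size → V
          τ a = σ (toℕ (at a))

          τ-injective : Injective _≡_ _≡_ τ
          τ-injective eq = strictlyMonotone⇒injective at monotone
            (toℕ-injective (position-injective O (toℕ<n (at _)) (toℕ<n (at _)) eq))

        -- If σ u and σ w are adjacent with u < w, then every position in (u , w] has its
        -- parent at or before u, so no two of them have a common descendant.
        short-edge : ∀ a b → toℕ a < toℕ b → Edge G (τ a) (τ b) → toℕ b ∸ toℕ a ≤ q
        short-edge a b a<b e = ≮⇒≥ λ q<b∸a → absurd q<b∸a (pigeonhole ≤-refl (descendant q<b∸a))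
          where
          module _ (q<b∸a : q < toℕ b ∸ toℕ a) where

            -- The q + 1 ranks directly after `a`. If the edge spans more than q ranks, none of them
            -- exceeds `b`; sending each to a terminal below it then causes a collision.
            past-a : Fin (suc q) → ℕ
            past-a x = suc (toℕ a + toℕ x)

            past-a≤b : ∀ x → past-a x ≤ toℕ b
            past-a≤b x = subst (past-a x ≤_) (m+[n∸m]≡n (<⇒≤ a<b))
              (+-monoʳ-< (toℕ a) (<-≤-trans (toℕ<n x) q<b∸a))

            between : Fin (suc q) → Fin size
            between x = fromℕ< (≤-<-trans (past-a≤b x) (toℕ<n b))

            toℕ-between : ∀ x → toℕ (between x) ≡ past-a x
            toℕ-between x = toℕ-fromℕ< (≤-<-trans (past-a≤b x) (toℕ<n b))

            a<between : ∀ x → toℕ (at a) < toℕ (at (between x))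
            a<between x = monotone a (between x)
              (subst (toℕ a <_) (sym (toℕ-between x)) (s≤s (m≤m+n (toℕ a) (toℕ x))))

            between≤b : ∀ x → toℕ (at (between x)) ≤ toℕ (at b)
            between≤b x with m≤n⇒m<n∨m≡n (subst (_≤ toℕ b) (sym (toℕ-between x)) (past-a≤b x))
            ... | inj₁ x<b = <⇒≤ (monotone _ _ x<b)
            ... | inj₂ x≡b = ≤-reflexive (cong (toℕ ∘ at) (toℕ-injective x≡b))

            below-terminal : ∀ x → ∃[ j ] Ancestor (toℕ (at (between x))) (terminal j)
            below-terminal x with sound (between x)
            -- An element after `a` is not the root, so it was selected as an ancestor of a
            -- terminal.
            ... | inj₁ x≡0 = contradiction (subst (toℕ (at a) <_) x≡0 (a<between x)) λ ()
            ... | inj₂ p   = p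

            descendant : Fin (suc q) → Fin q
            descendant x = proj₁ (below-terminal x)

            absurd : ¬ (∃[ x ] ∃[ y ] (toℕ x < toℕ y × descendant x ≡ descendant y))
            -- Both are ancestors of one terminal, so the earlier is at most the parent of the
            -- later, hence at most the position of `a`, which it was to follow.
            absurd (x , y , x<y , eq) = <⇒≱ (a<between x) (begin
              toℕ (at (between x))      ≤⟨ ancestors-comparable anc-x (proj₂ (below-terminal y)) at-x<at-y ⟩
              π (toℕ (at (between y)))  ≤⟨ π-mono (between≤b y) (toℕ<n (at b)) ⟩
              π (toℕ (at b))            ≤⟨ π-first (toℕ<n (at b)) (monotone a b a<b) e ⟩
              toℕ (at a)                ∎)
              where
              open ≤-Reasoning
              anc-x : Ancestor (toℕ (at (between x))) (terminal (descendant y))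
              anc-x = subst (λ j → Ancestor _ (terminal j)) eq (proj₂ (below-terminal x))
              at-x<at-y : toℕ (at (between x)) < toℕ (at (between y))
              at-x<at-y = monotone _ _
                (subst₂ _<_ (sym (toℕ-between x)) (sym (toℕ-between y)) (s≤s (+-monoʳ-< (toℕ a) x<y)))

        hull-bandwidth : BandwidthAtMost G InHull q
        hull-bandwidth = size , τ , τ-injective , inHull , covers , short
          where
          inHull : ∀ a → InHull (τ a)
          inHull a = _ , toℕ<n (at a) , refl , sound a
          covers : ∀ v → InHull v → ∃[ a ] τ a ≡ v
          covers _ (i , i<m , refl , Si) with complete (fromℕ< i<m) (subst Selected (sym (toℕ-fromℕ< i<m)) Si)
          ... | a , eq = a , cong σ (trans (cong toℕ eq) (toℕ-fromℕ< i<m))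
          short : ∀ a b → Edge G (τ a) (τ b) → ∣ toℕ a - toℕ b ∣ ≤ q
          short a b e with <-cmp (toℕ a) (toℕ b)
          ... | tri< a<b _ _ = subst (_≤ q) (sym (m≤n⇒∣m-n∣≡n∸m (<⇒≤ a<b))) (short-edge a b a<b e)
          ... | tri≈ _ a≡b _ = ⊥-elim (Edge⇒≢ e (cong τ (toℕ-injective a≡b)))
          ... | tri> _ _ b<a = subst (_≤ q) (sym (m≤n⇒∣n-m∣≡n∸m (<⇒≤ b<a))) (short-edge b a b<a (Edge-sym e))

  -- Partial decompositions

  module _ {ℓ} (part : V → Maybe (Fin ℓ)) where

    Class : Fin ℓ → V → Set
    Class i v = part v ≡ just i

    Free : V → Set
    Free v = part v ≡ nothing

    Touches : V → Fin ℓ → Set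
    Touches v i = ∃[ x ] (Class i x × Edge G v x)

    Linked : Fin ℓ → Fin ℓ → Set
    Linked i j = ∃[ u ] ∃[ v ] (Class i u × Class j v × Edge G u v)

    class? : ∀ i → Decidable (Class i)
    class? i v = ≡-dec Fin._≟_ (part v) (just i)

    free? : Decidable Free
    free? v = ≡-dec Fin._≟_ (part v) nothing

    touches? : ∀ v i → Dec (Touches v i)
    touches? v i = any? (λ x → class? i x ×-dec Edge? v x)

    linked-sym : ∀ {i j} → Linked i j → Linked j i
    linked-sym (u , v , ui , vj , e) = v , u , vj , ui , Edge-sym e

  -- New classes get index zero, so i < j means that class j was chosen before class i.
  record Decomposition (b ℓ : ℕ) : Set where
    field
      part        : V → Maybe (Fin ℓ)
      connected   : ∀ i → ConnectedInduced G (Class part i)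
      bandwidth   : ∀ i → BandwidthAtMost G (Class part i) b
      elimination : ∀ i j k → toℕ i < toℕ j → toℕ i < toℕ k → j ≢ k →
        Linked part i j → Linked part i k → Linked part j k
      attachment  : ∀ {u v} → PathIn G (Free part) u v → ∀ {i j} → i ≢ j →
        Touches part u i → Touches part v j → Linked part i j

  empty : ∀ {b} → Decomposition b 0
  empty = record
    { part = λ _ → nothing ; connected = λ () ; bandwidth = λ ()
    ; elimination = λ () ; attachment = λ _ {i} → ⊥-elim (Fin.¬Fin0 i) }

  -- Representatives of distinct classes are distinct vertices. This bounds the number of rounds of
  -- the greedy choice.
  decomposition-size : ∀ {b ℓ} → Decomposition b ℓ → ℓ ≤ n
  decomposition-size {ℓ = ℓ} D = ≮⇒≥ λ n<ℓ → absurd (pigeonhole n<ℓ representative)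
    where
    open Decomposition D
    representative : Fin ℓ → V
    representative i = proj₁ (proj₁ (connected i))
    in-class : ∀ i → Class part i (representative i)
    in-class i = proj₂ (proj₁ (connected i))
    absurd : ¬ (∃[ i ] ∃[ j ] (toℕ i < toℕ j × representative i ≡ representative j))
    absurd (i , j , i<j , eq) = <-irrefl (cong toℕ
      (just-injective (trans (sym (in-class i)) (trans (cong part eq) (in-class j))))) i<j

  -- Choosing the next class, with t = 3 + b.

  module _ {b} (noMinor : ¬ HasCompleteMinor G (3 + b)) where

    module _ {ℓ} (D : Decomposition b ℓ) where
      open Decomposition D

      -- The set `C` and the classes are the branch sets. Two of the classes are linked by
      -- `attachment`, applied to a path inside `C` between vertices touching them.
      component+classes⇒minor : {C : V → Set} → Decidable C → (∀ {v} → C v → Free part v) →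
        ConnectedInduced G C →
        ∀ {k} (d : Fin k → Fin ℓ) → Injective _≡_ _≡_ d →
        (∀ a → ∃[ v ] (C v × Touches part v (d a))) →
        HasCompleteMinor G (suc k)
      component+classes⇒minor {C} C? C-free C-conn {k} d d-inj touch =
        branchSets⇒minor B B? disjoint conn adjacent
        where
        B : Fin (suc k) → V → Set
        B zero    = C
        B (suc a) = Class part (d a)
        B? : ∀ a → Decidable (B a)
        B? zero    = C?
        B? (suc a) = class? part (d a)
        free≢class : ∀ {v a} → C v → ¬ Class part (d a) v
        free≢class Cv v∈d with trans (sym (C-free Cv)) v∈d
        ... | ()
        disjoint : ∀ {i j v} → B i v → B j v → i ≡ j
        disjoint {zero}  {zero}  _ _ = refl
        disjoint {zero}  {suc _} p q = ⊥-elim (free≢class p q)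
        disjoint {suc _} {zero}  p q = ⊥-elim (free≢class q p)
        disjoint {suc _} {suc _} p q = cong suc (d-inj (just-injective (trans (sym p) q)))
        conn : ∀ i → ConnectedInduced G (B i)
        conn zero    = C-conn
        conn (suc a) = connected (d a)
        adjacent : ∀ i j → i ≢ j → ∃[ u ] ∃[ v ] (B i u × B j v × Edge G u v)
        adjacent zero zero 0≢0 = ⊥-elim (0≢0 refl)
        adjacent zero (suc a) _ with touch a
        ... | v , Cv , x , x∈d , vx = v , x , Cv , x∈d , vx
        adjacent (suc a) zero _ with touch a
        ... | v , Cv , x , x∈d , vx = x , v , x∈d , Cv , Edge-sym vx
        adjacent (suc a) (suc a′) a≢a′ with touch a | touch a′
        ... | v , Cv , ta | v′ , Cv′ , ta′ =
          attachment (path-map C-free (proj₂ C-conn v v′ Cv Cv′)) (a≢a′ ∘ cong suc ∘ d-inj) ta ta′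

      module AddClass {H : V → Set} (H? : Decidable H) (H-free : ∀ {v} → H v → Free part v) where

        part′ : V → Maybe (Fin (suc ℓ))
        part′ v with H? v
        ... | yes _ = just zero
        ... | no _  = Maybe.map suc (part v)

        new⁺ : ∀ {v} → H v → Class part′ zero v
        new⁺ {v} Hv with H? v
        ... | yes _  = refl
        ... | no ¬Hv = ⊥-elim (¬Hv Hv)

        new⁻ : ∀ {v} → Class part′ zero v → H v
        new⁻ {v} eq with H? v
        ... | yes Hv = Hv
        ... | no _ with part v
        new⁻ () | no _ | just _
        new⁻ () | no _ | nothing

        old⁺ : ∀ {i v} → Class part i v → Class part′ (suc i) v
        old⁺ {i} {v} eq with H? v
        ... | no _ = cong (Maybe.map suc) eq
        ... | yes Hv with trans (sym (H-free Hv)) eq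
        ...   | ()

        old⁻ : ∀ {i v} → Class part′ (suc i) v → Class part i v
        old⁻ {i} {v} eq with H? v
        ... | no _ with part v
        old⁻ refl | no _ | just _ = refl

        free⁻ : ∀ {v} → Free part′ v → Free part v
        free⁻ {v} eq with H? v
        ... | no _ with part v
        ...   | nothing = refl

        touches⁻ : ∀ {i v} → Touches part′ v (suc i) → Touches part v i
        touches⁻ (x , xi , e) = x , old⁻ xi , e

        linked⁺ : ∀ {i j} → Linked part i j → Linked part′ (suc i) (suc j)
        linked⁺ (u , v , ui , vj , e) = u , v , old⁺ ui , old⁺ vj , e

        linked⁻ : ∀ {i j} → Linked part′ (suc i) (suc j) → Linked part i j
        linked⁻ (u , v , ui , vj , e) = u , v , old⁻ ui , old⁻ vj , e

        -- The last hypothesis says that `H` itself touches every class touched by its free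
        -- component. It preserves `attachment`: whatever remains free next to `H` comes from that
        -- component.
        addClass : ConnectedInduced G H → BandwidthAtMost G H b →
          (∀ {u v i} → H u → PathIn G (Free part) u v → Touches part v i →
            ∃[ x ] (H x × Touches part x i)) →
          Decomposition b (suc ℓ)
        addClass H-conn H-bw absorb = record
          { part = part′ ; connected = connected′ ; bandwidth = bandwidth′
          ; elimination = elimination′ ; attachment = attachment′ }
          where
          connected′ : ∀ i → ConnectedInduced G (Class part′ i)
          connected′ zero    = connected-resp new⁺ new⁻ H-conn
          connected′ (suc i) = connected-resp old⁺ old⁻ (connected i)
          bandwidth′ : ∀ i → BandwidthAtMost G (Class part′ i) b
          bandwidth′ zero    = bandwidth-resp new⁺ new⁻ H-bw
          bandwidth′ (suc i) = bandwidth-resp old⁺ old⁻ (bandwidth i)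
          elimination′ : ∀ i j k → toℕ i < toℕ j → toℕ i < toℕ k → j ≢ k →
            Linked part′ i j → Linked part′ i k → Linked part′ j k
          -- The new class was a connected set of free vertices, so the old `attachment` links any
          -- two classes that it touches.
          elimination′ zero (suc j) (suc k) _ _ j≢k (u , x , Hu , xj , ux) (v , y , Hv , yk , vy) =
            linked⁺ (attachment (path-map H-free (proj₂ H-conn u v (new⁻ Hu) (new⁻ Hv)))
              (j≢k ∘ cong suc) (x , old⁻ xj , ux) (y , old⁻ yk , vy))
          elimination′ (suc i) (suc j) (suc k) i<j i<k j≢k p q =
            linked⁺ (elimination i j k (s≤s⁻¹ i<j) (s≤s⁻¹ i<k) (j≢k ∘ cong suc) (linked⁻ p) (linked⁻ q))
          new-linked : ∀ {u v j} → PathIn G (Free part′) u v →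
            Touches part′ u zero → Touches part′ v (suc j) → Linked part′ zero (suc j)
          new-linked p (x , xH , ux) vj
            -- Before `H` became a class, the walk from `x` through `u` to `v` was free throughout.
            with absorb (new⁻ xH) (step (H-free (new⁻ xH)) (Edge-sym ux) (path-map free⁻ p)) (touches⁻ vj)
          ... | y , Hy , z , zj , yz = y , z , new⁺ Hy , old⁺ zj , yz
          attachment′ : ∀ {u v} → PathIn G (Free part′) u v → ∀ {i j} → i ≢ j →
            Touches part′ u i → Touches part′ v j → Linked part′ i j
          attachment′ p {zero}  {zero}  0≢0 _ _ = ⊥-elim (0≢0 refl)
          attachment′ p {zero}  {suc j} _ ui vj = new-linked p ui vj
          attachment′ p {suc i} {zero}  _ ui vj = linked-sym part′ (new-linked (path-sym p) vj ui)
          attachment′ p {suc i} {suc j} i≢j ui vj =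
            linked⁺ (attachment (path-map free⁻ p) (i≢j ∘ cong suc) (touches⁻ ui) (touches⁻ vj))

      AttachedRoot : V → Set
      AttachedRoot r = ∀ v i → Free part v → Touches part v i → ∃ (Touches part r)

      -- Any free vertex touching a class will do, in whichever component it lies. If there is none,
      -- the condition is vacuous and `v` serves as root.
      chooseRoot : ∀ {v} → Free part v → ∃[ r ] (Free part r × AttachedRoot r)
      chooseRoot {v} v-free with any? (λ v → free? part v ×-dec any? (touches? part v))
      ... | yes (r , r-free , t) = r , r-free , λ _ _ _ _ → t
      ... | no none = v , v-free , λ u i u-free t → ⊥-elim (none (u , u-free , i , t))

      -- The hull of the terminals in the component of the root as the next class.

      module Grow {r} (r-free : Free part r) (r-root : AttachedRoot r)
        {m} (O : SearchOrder (free? part) r-free m)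
        (saturated : Saturated (free? part) r-free (SearchOrder.σ O) m) where
        open SearchOrder O

        Component : V → Set
        Component = Visited (free? part) r-free σ m

        component-free : ∀ {v} → Component v → Free part v
        component-free (i , i<m , refl) = inU i<m

        root∈component : Component r
        root∈component = 0 , nonempty , root

        component-closed : ∀ {u v} → PathIn G (Free part) u v → Component u → Component v
        component-closed (here _)     u∈C = u∈C
        component-closed (step _ e p) (i , i<m , refl) =
          component-closed p (saturated i<m (path-start p) e)

        component-connected : ConnectedInduced G Component
        component-connected = connected-to root∈component
          λ { _ (i , i<m , refl) → go i (<-wellFounded i) i<m }
          where
          go : ∀ i → Acc _<_ i → i < m → PathIn G Component (σ i) r
          go zero    _        i<m = subst (PathIn G Component (σ 0)) root (here (0 , i<m , refl))
          go (suc i) (acc rs) i<m = step (_ , i<m , refl) (Edge-sym (π-edge z<s i<m))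
            (go (π (suc i)) (rs (π< z<s)) (<-trans (π< z<s) i<m))

        -- The root itself touches one class (if any is touched at all); each further class costs
        -- one terminal, which is why the hull has bandwidth t - 3 and not t - 2.
        Extra : Fin ℓ → Set
        Extra i = ¬ Touches part r i × ∃[ a ] (a < m × Touches part (σ a) i)

        extra? : Decidable Extra
        extra? i = ¬? (touches? part r i) ×-dec anyUpTo? (λ a → touches? part (σ a) i) m

        open Enumeration (enumerate extra?)

        terminal : Fin size → ℕ
        terminal a = proj₁ (proj₂ (sound a))

        terminal<m : ∀ a → terminal a < m
        terminal<m a = proj₁ (proj₂ (proj₂ (sound a)))

        terminal-touches : ∀ a → Touches part (σ (terminal a)) (at a)
        terminal-touches a = proj₂ (proj₂ (proj₂ (sound a)))

        -- Otherwise b + 1 extra classes, one class touched by the root and the component form a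
        -- complete minor on 3 + b branch sets.
        size≤b : size ≤ b
        size≤b = ≮⇒≥ λ b<size → noMinor (minor b<size)
          where
          module _ (b<size : b < size) where
            e : Fin (suc b) → Fin size
            e a = inject≤ a b<size
            rootClass : ∃ (Touches part r)
            -- An extra class is touched by a free vertex, so the root touches some class as well,
            -- and that one is not extra.
            rootClass = r-root _ _ (inU (terminal<m (e zero))) (terminal-touches (e zero))
            d : Fin (2 + b) → Fin ℓ
            d zero    = proj₁ rootClass
            d (suc a) = at (e a)
            root≢extra : ∀ a → proj₁ rootClass ≢ at a
            root≢extra a eq = proj₁ (sound a) (subst (Touches part r) eq (proj₂ rootClass))
            d-injective : Injective _≡_ _≡_ d
            d-injective {zero}  {zero}  _  = refl
            d-injective {zero}  {suc a} eq = ⊥-elim (root≢extra _ eq)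
            d-injective {suc a} {zero}  eq = ⊥-elim (root≢extra _ (sym eq))
            d-injective {suc a} {suc c} eq = cong suc
              (inject≤-injective b<size b<size a c (strictlyMonotone⇒injective at monotone eq))
            touch : ∀ a → ∃[ v ] (Component v × Touches part v (d a))
            touch zero    = r , root∈component , proj₂ rootClass
            touch (suc a) = _ , (_ , terminal<m (e a) , refl) , terminal-touches (e a)
            minor : HasCompleteMinor G (3 + b)
            minor = component+classes⇒minor (visited? (free? part) r-free σ m)
              component-free component-connected d d-injective touch

        open Ancestry (free? part) r-free O using (self)
        open Ancestry.Hull (free? part) r-free O terminal

        hull⊆component : ∀ {v} → InHull v → Component v
        hull⊆component (i , i<m , eq , _) = i , i<m , eq

        -- A class touched by the component is touched by the root or is extra and touched by its
        -- own terminal; the hull contains both.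
        absorb : ∀ {u v i} → InHull u → PathIn G (Free part) u v → Touches part v i →
          ∃[ x ] (InHull x × Touches part x i)
        absorb {i = i} Hu p vi with touches? part r i
        ... | yes ri = r , subst InHull root root∈hull , ri
        ... | no ¬ri with component-closed p (hull⊆component Hu)
        ...   | j , j<m , refl with complete i (¬ri , j , j<m , vi)
        ...     | a , refl = _ , (_ , terminal<m a , refl , inj₂ (a , self)) , terminal-touches a

        grow : Decomposition b (suc ℓ)
        grow = AddClass.addClass inHull? (component-free ∘ hull⊆component) hull-connected
          (bandwidth-mono size≤b hull-bandwidth) absorb
          where
          bandwidth-mono : ∀ {S k k′} → k ≤ k′ → BandwidthAtMost G S k → BandwidthAtMost G S k′
          bandwidth-mono k≤k′ (M , τ , inj , snd , cov , short) =
            M , τ , inj , snd , cov , λ a c e → ≤-trans (short a c e) k≤k′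

      addFree : ∀ {v} → Free part v → Decomposition b (suc ℓ)
      addFree v-free with chooseRoot v-free
      ... | r , r-free , r-root with search (free? part) r-free
      ...   | m , O , saturated = Grow.grow r-free r-root O saturated

    -- From a total decomposition to the chordal partition.

    Total : ∀ {ℓ} → Decomposition b ℓ → Set
    Total D = ∀ v → ∃[ i ] Class (Decomposition.part D) i v

    -- The fuel `k` suffices because each round adds a class and there are never more than n
    -- classes.
    complete-decomposition : ∀ k {ℓ} → Decomposition b ℓ → ℓ + k ≡ suc n →
      ∃[ ℓ ] Σ (Decomposition b ℓ) Total
    complete-decomposition zero {ℓ} D eq =
      ⊥-elim (<-irrefl refl (subst (_≤ n) (trans (sym (+-identityʳ ℓ)) eq) (decomposition-size D)))
    complete-decomposition (suc k) {ℓ} D eq with any? (free? (Decomposition.part D))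
    ... | yes (v , v-free) = complete-decomposition k (addFree D v-free) (trans (sym (+-suc ℓ k)) eq)
    ... | no none = ℓ , D , total
      where
      total : Total D
      total v with Decomposition.part D v in eq
      ... | just i  = i , refl
      ... | nothing = ⊥-elim (none (v , eq))

    chordalPartition : Σ ℕ λ ℓ → Σ (V → Fin ℓ) λ part →
      IsConnectedPartition G ℓ part ×
      Chordal (QuotientAdj G ℓ part) ×
      CliqueNumberAtMost (QuotientAdj G ℓ part) (2 + b) ×
      (∀ i → BandwidthAtMost G (λ v → part v ≡ i) b)
    chordalPartition with complete-decomposition (suc n) empty refl
    ... | ℓ , D , total = ℓ , class , conn ,
      perfectElimination⇒chordal Q-sym Q-elim , clique ,
      λ i → bandwidth-resp to from (bandwidth i)
      where
      open Decomposition D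
      class : V → Fin ℓ
      class v = proj₁ (total v)
      to : ∀ {i v} → Class part i v → class v ≡ i
      to {v = v} v∈i = just-injective (trans (sym (proj₂ (total v))) v∈i)
      from : ∀ {i v} → class v ≡ i → Class part i v
      from {v = v} refl = proj₂ (total v)
      conn : IsConnectedPartition G ℓ class
      conn i = connected-resp to from (connected i)
      Q-sym : ∀ {i j} → QuotientAdj G ℓ class i j → QuotientAdj G ℓ class j i
      Q-sym (i≢j , u , v , ui , vj , e) = ≢-sym i≢j , v , u , vj , ui , Edge-sym e
      linked : ∀ {i j} → QuotientAdj G ℓ class i j → Linked part i j
      linked (_ , u , v , ui , vj , e) = u , v , from ui , from vj , e
      Q-elim : ∀ i j k → toℕ i < toℕ j → toℕ i < toℕ k → j ≢ k →
        QuotientAdj G ℓ class i j → QuotientAdj G ℓ class i k → QuotientAdj G ℓ class j k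
      Q-elim i j k i<j i<k j≢k p q with elimination i j k i<j i<k j≢k (linked p) (linked q)
      ... | u , v , uj , vk , e = j≢k , u , v , to uj , to vk , e
      clique : CliqueNumberAtMost (QuotientAdj G ℓ class) (2 + b)
      -- A clique on 3 + b vertices of the quotient is a complete minor with the classes themselves
      -- as branch sets.
      clique (c , c-inj , adjacent) = noMinor (branchSets⇒minor
        (λ i v → class v ≡ c i) (λ i v → class v Fin.≟ c i)
        (λ p q → c-inj (trans (sym p) q)) (conn ∘ c)
        λ i j i≢j → proj₂ (adjacent i j i≢j))

theorem4 : (t : ℕ) → 4 ≤ t → (G : Graph) → ¬ HasCompleteMinor G t →
    Σ ℕ λ ℓ → Σ (Fin (Graph.n G) → Fin ℓ) λ part →
    IsConnectedPartition G ℓ part ×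
    Chordal (QuotientAdj G ℓ part) ×
    CliqueNumberAtMost (QuotientAdj G ℓ part) (t ∸ 1) ×
    (∀ i → BandwidthAtMost G (λ v → part v ≡ i) (t ∸ 3))
-- With t written as 3 + b, the bounds t - 1 and t - 3 compute to 2 + b and b.
theorem4 (suc (suc (suc b))) _ G noMinor = chordalPartition G noMinor
theorem4 (suc zero) (s≤s ())
theorem4 (suc (suc zero)) (s≤s (s≤s ()))
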